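{- Let $n \ge 2$ and $k \ge 1$ be integers. For $i=1,\ldots,k$, let player $i$ hold a finite sequence (i.e., a multiset) $A_i$ whose support is a subset of $[n]=\{1,2,\ldots,n\}$ and with $|A_i|=O(\mathrm{poly}(n))$; not all $A_i$ are empty. Then there is a deterministic protocol for finding the median of the multiset sum $\biguplus_{i=1}^k A_i$ with communication complexity $O(k\log^2 n)$.
   Context: Multiparty communication model: each of the $k$ players knows only his/her own input $A_i$ (and the public parameters $n$, $k$). Players communicate by broadcasting bits: every message sent by one player is seen by all players (blackboard). A deterministic protocol specifies, as a function of the messages sent so far, who speaks next, and each message is a function of the speaker's own input and the messages so far. At the end of the protocol the required output is known to the players. The communication complexity of a protocol is the maximum, over all admissible inputs, of the total number of bits broadcast; local computation is free. Median: the median of a finite nonempty multiset $X$ is its $\lceil |X|/2\rceil$-th smallest element, counted with multiplicity. The multiset sum $\biguplus$ adds multiplicities, so $|\biguplus_i A_i|=\sum_i |A_i|$. The hypothesis $|A_i|=O(\mathrm{poly}(n))$ means that there is a fixed polynomial in $n$ (independent of $i$ and $k$) bounding all $|A_i|$. The number of players $k$ is independent of $n$; the constant implied in $O(k\log^2 n)$ depends only on that polynomial bound, not on $n$ or $k$. Logarithms are in base $2$. -}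

module Defs where

open import Data.Bool.Base using (Bool)
open import Data.Fin.Base using (Fin)
open import Data.Fin.Properties using (≤-decTotalOrder)
open import Data.List.Base using (List; []; length; head; drop; concat; tabulate; foldr)
import Data.List.Sort as Sort
open import Data.Maybe.Base using (Maybe; just)
open import Data.Nat.Base using (ℕ; suc; _+_; _*_; _∸_; _≤_; ⌈_/2⌉)
open import Data.Product.Base using (_×_)
open import Relation.Binary.PropositionalEquality.Core using (_≡_)
open import Relation.Nullary.Negation.Core using (¬_)

-- A deterministic blackboard protocol for k players with private inputs in I
-- and common output in O, as a tree.  The node reached is determined by the
-- bits broadcast so far, so the next speaker, the next bit (given the speaker's
-- input) and the final output may all depend on the transcript.  A longer
-- message is a succession of nodes with the same speaker.  The output is read
-- off the transcript alone, so every player knows it.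

data Protocol (k : ℕ) (I O : Set) : Set where
  output : O → Protocol k I O
  speak  : (i : Fin k) (bit : I → Bool) (next : Bool → Protocol k I O) →
           Protocol k I O

module _ {k : ℕ} {I O : Set} where

  run : Protocol k I O → (Fin k → I) → O
  run (output o)         A = o
  run (speak i bit next) A = run (next (bit (A i))) A

  bitsBroadcast : Protocol k I O → (Fin k → I) → ℕ
  bitsBroadcast (output o)         A = 0
  bitsBroadcast (speak i bit next) A = suc (bitsBroadcast (next (bit (A i))) A)

  -- The maximum of bitsBroadcast over the inputs satisfying Adm is at most b.

  ComplexityAtMost : ((Fin k → I) → Set) → Protocol k I O → ℕ → Set
  ComplexityAtMost Adm P b = ∀ A → Adm A → bitsBroadcast P A ≤ b

-- A finite multiset with support in [n] is a list over Fin n, with x : Fin n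
-- standing for the number toℕ x + 1; only multiplicities matter below.

Multiset : ℕ → Set
Multiset n = List (Fin n)

⨄ : ∀ {k n} → (Fin k → Multiset n) → Multiset n
⨄ A = concat (tabulate A)

-- Positions in a list count from 0, hence the ∸ 1; the result is nothing
-- exactly when X is empty.

median : ∀ {n} → Multiset n → Maybe (Fin n)
median {n} X = head (drop (⌈ length X /2⌉ ∸ 1) (sort X))
  where open Sort (≤-decTotalOrder n) using (sort)

-- Coefficients in increasing degree.  Natural coefficients lose nothing: every
-- real polynomial is bounded on ℕ by one of these.

Polynomial : Set
Polynomial = List ℕ

eval : Polynomial → ℕ → ℕ
eval p n = foldr (λ a r → a + n * r) 0 p

Admissible : ∀ {k n} → Polynomial → (Fin k → Multiset n) → Set
Admissible {n = n} p A = (∀ i → length (A i) ≤ eval p n) × ¬ (∀ i → A i ≡ [])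

FindsMedian : ∀ {k n} → Polynomial → Protocol k (Multiset n) (Fin n) → Set
FindsMedian p P = ∀ A → Admissible p A → median (⨄ A) ≡ just (run P A)

{-# OPTIONS --safe #-}

-- The element y at position j of a sorted list satisfies m ≤ y exactly when at
-- most j entries lie below m.  After the players have announced their sizes, j
-- is known, and y is found by bisection: at each of the O(log n) steps every
-- player announces how many of its entries lie below the current midpoint, a
-- number of O(log n) bits since it is at most polynomial in n.  A player
-- announces a number by the same bisection, each comparison costing one bit.

module Submission where

open import Data.Bool.Base using (Bool; if_then_else_)
open import Data.Fin.Base using (Fin; zero; suc; toℕ)
import Data.Fin.Properties as Fin
open import Data.Fin.Properties using (toℕ<n; toℕ-fromℕ<; toℕ-injective)
open import Data.List.Base
  using (List; []; _∷_; _++_; length; head; drop; concat; tabulate; map; filter; allFin)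
open import Data.List.Properties
  using (length-++; length-filter; length-tabulate; filter-++; filter-accept; filter-none;
         map-tabulate; ++-conicalˡ; ++-conicalʳ)
open import Data.List.Relation.Binary.Permutation.Propositional using (_↭_)
open import Data.List.Relation.Binary.Permutation.Propositional.Properties
  using (↭-length; filter-↭)
open import Data.List.Relation.Unary.All as All using (All; []; _∷_)
open import Data.List.Relation.Unary.AllPairs using (AllPairs; _∷_)
open import Data.List.Relation.Unary.Sorted.TotalOrder.Properties using (Sorted⇒AllPairs)
import Data.List.Sort as Sort
open import Data.Maybe.Base using (just)
open import Data.Nat.Base
  using (ℕ; zero; suc; _+_; _*_; _∸_; _^_; _≤_; _<_; z≤n; s≤s; ⌈_/2⌉; NonZero; >-nonZero)
open import Data.Nat.DivMod using (_mod_; m%n<n; m<n⇒m%n≡m)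
open import Data.Nat.ListAction using (sum)
open import Data.Nat.Logarithm using (⌊log₂_⌋; ⌊log₂⌋-mono-≤; ⌊log₂[2^n]⌋≡n)
open import Data.Nat.Properties
open import Data.Nat.Tactic.RingSolver using (solve-∀)
open import Data.Product.Base using (_×_; _,_; Σ-syntax; ∃-syntax)
open import Function.Base using (_∘_; id)
open import Function.Bundles using (_⇔_; mk⇔; Equivalence)
open import Relation.Binary.PropositionalEquality
  using (_≡_; refl; sym; trans; cong; subst; module ≡-Reasoning)
open import Relation.Nullary.Decidable using (Dec; does; yes; no; does-⇔)
open import Relation.Nullary.Negation using (¬_; contradiction)
open import Defs

-- Protocol fragments: bisection and announcements.

module _ {k : ℕ} {I O : Set} where

  -- A protocol fragment in continuation-passing style: next receives its result.
  Query : Set → Set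
  Query X = (X → Protocol k I O) → Protocol k I O

  Answers : ∀ {X} → Query X → (Fin k → I) → X → Set
  Answers q A x = ∀ next → run (q next) A ≡ run (next x) A

  -- The bound on `next` is demanded for every result, not only the correct one, so costs compose
  -- without any appeal to `Answers`.
  Costs : ∀ {X} → Query X → (Fin k → I) → ℕ → Set
  Costs q A c = ∀ next b → (∀ x → bitsBroadcast (next x) A ≤ b) →
                bitsBroadcast (q next) A ≤ c + b

  -- The remaining candidates are the `2 ^ d` values from `lo` on; a power of two is halved exactly,
  -- so `d` tests leave only `lo`.
  bisect : (ℕ → Query Bool) → ℕ → ℕ → Query ℕ
  bisect test zero    lo next = next lo
  bisect test (suc d) lo next =
    test (lo + 2 ^ d) λ above → bisect test d (if above then lo + 2 ^ d else lo) next

  bisect-answers : ∀ {test A t} → (∀ m → Answers (test m) A (does (m ≤? t))) →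
                   ∀ d {lo} → lo ≤ t → t < lo + 2 ^ d → Answers (bisect test d lo) A t
  bisect-answers {A = A} {t = t} test-answers zero {lo} lo≤t t<hi next =
    cong (λ x → run (next x) A)
      (≤-antisym lo≤t (m<1+n⇒m≤n (subst (t <_) (+-comm lo 1) t<hi)))
  bisect-answers {test} {A} {t} test-answers (suc d) {lo} lo≤t t<hi next =
    trans (test-answers mid _) (branch (mid ≤? t))
    where
    mid = lo + 2 ^ d

    hi≡mid+2^d : lo + 2 ^ suc d ≡ mid + 2 ^ d
    hi≡mid+2^d = trans (cong (λ z → lo + (2 ^ d + z)) (+-identityʳ (2 ^ d)))
                       (sym (+-assoc lo (2 ^ d) (2 ^ d)))

    branch : (above : Dec (mid ≤ t)) →
             run (bisect test d (if does above then mid else lo) next) A ≡ run (next t) A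
    branch (yes mid≤t) =
      bisect-answers test-answers d mid≤t (subst (t <_) hi≡mid+2^d t<hi) next
    branch (no mid≰t)  = bisect-answers test-answers d lo≤t (≰⇒> mid≰t) next

  bisect-costs : ∀ {test A c} → (∀ m → Costs (test m) A c) →
                 ∀ d lo → Costs (bisect test d lo) A (d * c)
  bisect-costs test-costs zero    lo next b next≤b = next≤b lo
  bisect-costs {c = c} test-costs (suc d) lo next b next≤b =
    ≤-trans (test-costs _ _ _ λ above → bisect-costs test-costs d _ next b next≤b)
            (≤-reflexive (sym (+-assoc c (d * c) b)))

  announce : ℕ → (I → ℕ) → Fin k → Query ℕ
  announce w f i = bisect (λ m → speak i (λ a → does (m ≤? f a))) w 0

  announce-answers : ∀ w f i {A} → f (A i) < 2 ^ w → Answers (announce w f i) A (f (A i))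
  announce-answers w f i f<2^w = bisect-answers (λ m next → refl) w z≤n f<2^w

  announce-costs : ∀ w f i {A} → Costs (announce w f i) A w
  announce-costs w f i {A} = subst (Costs _ A) (*-identityʳ w)
    (bisect-costs (λ m next b next≤b → s≤s (next≤b _)) w 0)

  announceSum : ℕ → (I → ℕ) → List (Fin k) → Query ℕ
  announceSum w f []       next = next 0
  announceSum w f (i ∷ is) next =
    announce w f i λ x → announceSum w f is λ s → next (x + s)

  announceSum-answers : ∀ w f {A} → (∀ i → f (A i) < 2 ^ w) → ∀ is →
                        Answers (announceSum w f is) A (sum (map (f ∘ A) is))
  announceSum-answers w f f<2^w []       next = refl
  announceSum-answers w f f<2^w (i ∷ is) next =
    trans (announce-answers w f i (f<2^w i) _) (announceSum-answers w f f<2^w is _)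

  announceSum-costs : ∀ w f {A} is → Costs (announceSum w f is) A (length is * w)
  announceSum-costs w f []       next b next≤b = next≤b 0
  announceSum-costs w f (i ∷ is) next b next≤b =
    ≤-trans (announce-costs w f i _ _ λ x → announceSum-costs w f is _ b λ s → next≤b (x + s))
            (≤-reflexive (sym (+-assoc w (length is * w) b)))

-- Additive functions on the multiset sum.

-- Applied to `length` and to `countBelow m`: the players' announced numbers add up to the value for
-- the whole multiset.
additive-⨄ : ∀ {n} (h : Multiset n → ℕ) → h [] ≡ 0 → (∀ xs ys → h (xs ++ ys) ≡ h xs + h ys) →
             ∀ {k} (A : Fin k → Multiset n) → sum (map (h ∘ A) (allFin k)) ≡ h (⨄ A)
additive-⨄ h h-[] h-++ A =
  trans (cong sum (trans (map-tabulate id (h ∘ A)) (sym (map-tabulate A h))))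
        (additive-concat (tabulate A))
  where
  additive-concat : ∀ xss → sum (map h xss) ≡ h (concat xss)
  additive-concat []         = sym h-[]
  additive-concat (xs ∷ xss) =
    trans (cong (h xs +_) (additive-concat xss)) (sym (h-++ xs (concat xss)))

⨄≡[]⇒≡[] : ∀ {k n} (A : Fin k → Multiset n) → ⨄ A ≡ [] → ∀ i → A i ≡ []
⨄≡[]⇒≡[] A eq zero    = ++-conicalˡ (A zero) _ eq
⨄≡[]⇒≡[] A eq (suc i) = ⨄≡[]⇒≡[] (A ∘ suc) (++-conicalʳ (A zero) _ eq) i

0<length-⨄ : ∀ {k n} (A : Fin k → Multiset n) → ¬ (∀ i → A i ≡ []) → 0 < length (⨄ A)
0<length-⨄ A A≢[] with ⨄ A | ⨄≡[]⇒≡[] A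
... | []    | ≡[] = contradiction (≡[] refl) A≢[]
... | _ ∷ _ | _   = s≤s z≤n

-- Rank and median.

countBelow : ∀ {n} → ℕ → Multiset n → ℕ
countBelow m xs = length (filter (λ x → toℕ x <? m) xs)

countBelow-++ : ∀ {n} m (xs ys : Multiset n) →
                countBelow m (xs ++ ys) ≡ countBelow m xs + countBelow m ys
countBelow-++ m xs ys =
  trans (cong length (filter-++ (λ x → toℕ x <? m) xs ys)) (length-++ (filter _ xs))

countBelow-↭ : ∀ {n} m {xs ys : Multiset n} → xs ↭ ys → countBelow m xs ≡ countBelow m ys
countBelow-↭ m xs↭ys = ↭-length (filter-↭ (λ x → toℕ x <? m) xs↭ys)

countBelow-accept : ∀ {n m} {x : Fin n} xs → toℕ x < m →
                    countBelow m (x ∷ xs) ≡ suc (countBelow m xs)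
countBelow-accept {m = m} xs x<m = cong length (filter-accept (λ x → toℕ x <? m) {xs = xs} x<m)

countBelow-none : ∀ {n m} {xs : Multiset n} → All (λ x → m ≤ toℕ x) xs → countBelow m xs ≡ 0
countBelow-none {m = m} m≤xs = cong length (filter-none (λ x → toℕ x <? m) (All.map ≤⇒≯ m≤xs))

module _ {n : ℕ} where

  -- Induction on `j`. If the head lies below `m`, dropping it lowers both the count and the index
  -- by one. Otherwise sortedness puts every entry at or above `m`, so both sides of the equivalence
  -- hold.
  select-rank : ∀ {xs : Multiset n} → AllPairs (λ x y → toℕ x ≤ toℕ y) xs → ∀ j → j < length xs →
    ∃[ y ] (head (drop j xs) ≡ just y × ∀ m → countBelow m xs ≤ j ⇔ m ≤ toℕ y)
  select-rank {x ∷ xs} (x≤xs ∷ _) zero _ = x , refl , λ m → mk⇔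
    (λ c≤0 → ≮⇒≥ λ x<m → n≮0 (subst (_≤ 0) (countBelow-accept xs x<m) c≤0))
    (λ m≤x → ≤-reflexive (countBelow-none (m≤x ∷ All.map (≤-trans m≤x) x≤xs)))
  select-rank {x ∷ xs} (x≤xs ∷ xs↗) (suc j) (s≤s j<len)
    with y , eq , rank ← select-rank xs↗ j j<len = y , eq , λ m → shift m (rank m)
    where
    open Equivalence
    shift : ∀ {y : Fin n} m → countBelow m xs ≤ j ⇔ m ≤ toℕ y →
            countBelow m (x ∷ xs) ≤ suc j ⇔ m ≤ toℕ y
    shift m rank-m with toℕ x <? m
    ... | yes x<m = mk⇔
      (λ c≤1+j → to rank-m (≤-pred (subst (_≤ suc j) (countBelow-accept xs x<m) c≤1+j)))
      (λ m≤y → subst (_≤ suc j) (sym (countBelow-accept xs x<m)) (s≤s (from rank-m m≤y)))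
    ... | no x≮m = mk⇔
      (λ _ → to rank-m (subst (_≤ j) (sym (countBelow-none m≤xs)) z≤n))
      (λ _ → subst (_≤ suc j) (sym (countBelow-none (≮⇒≥ x≮m ∷ m≤xs))) z≤n)
      where
      m≤xs : All (λ z → m ≤ toℕ z) xs
      m≤xs = All.map (≤-trans (≮⇒≥ x≮m)) x≤xs

medianIndex : ℕ → ℕ
medianIndex N = ⌈ N /2⌉ ∸ 1

medianIndex< : ∀ {N} → 0 < N → medianIndex N < N
-- `⌈ suc N /2⌉` unfolds to `suc ⌊ N /2⌋`, so the index is `⌊ N /2⌋`.
medianIndex< {suc N} _ = s≤s (⌊n/2⌋≤n N)

-- Sorting permutes the entries and so preserves counts; the rank criterion can thus be tested on
-- the unsorted multiset.
median-rank : ∀ {n} (X : Multiset n) → 0 < length X →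
  ∃[ y ] (median X ≡ just y × ∀ m → countBelow m X ≤ medianIndex (length X) ⇔ m ≤ toℕ y)
median-rank {n} X 0<len =
  let y , eq , rank = select-rank (Sorted⇒AllPairs (Fin.≤-totalOrder n) (sort-↗ X)) j j<len
  in y , eq , λ m → subst (λ c → c ≤ j ⇔ m ≤ toℕ y) (countBelow-↭ m (sort-↭ X)) (rank m)
  where
  open Sort (Fin.≤-decTotalOrder n) using (sort; sort-↗; sort-↭)
  j = medianIndex (length X)

  j<len : j < length (sort X)
  j<len = subst (j <_) (sym (↭-length (sort-↭ X))) (medianIndex< 0<len)

-- The median protocol.

module _ (k n w l : ℕ) .{{_ : NonZero n}} where

  testMedian : ℕ → ℕ → Query {k} {Multiset n} {Fin n} Bool
  testMedian j m next = announceSum w (countBelow m) (allFin k) λ c → next (does (c ≤? j))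

  medianProtocol : Protocol k (Multiset n) (Fin n)
  medianProtocol = announceSum w length (allFin k) λ N →
    -- Bisection ranges over all values below `2 ^ l`, possibly beyond `n`; `mod` makes the output
    -- total and fixes the correct value, which is below `n`.
    bisect (testMedian (medianIndex N)) l 0 λ v → output (v mod n)

  medianProtocol-median : n ≤ 2 ^ l → ∀ A → (∀ i → length (A i) < 2 ^ w) → ¬ (∀ i → A i ≡ []) →
                          median (⨄ A) ≡ just (run medianProtocol A)
  medianProtocol-median n≤2^l A len<2^w A≢[]
    with y , eq , rank ← median-rank (⨄ A) (0<length-⨄ A A≢[])
    = trans eq (cong just (sym (begin
      run medianProtocol A
        ≡⟨ announceSum-answers w length len<2^w (allFin k) _ ⟩
      run (bisect (testMedian (medianIndex N)) l 0 λ v → output (v mod n)) A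
        ≡⟨ cong (λ N → run (bisect (testMedian (medianIndex N)) l 0 λ v → output (v mod n)) A)
             (additive-⨄ length refl (λ xs ys → length-++ xs) A) ⟩
      run (bisect (testMedian j) l 0 λ v → output (v mod n)) A
        ≡⟨ bisect-answers test-answers l z≤n (<-≤-trans (toℕ<n y) n≤2^l) _ ⟩
      toℕ y mod n
        ≡⟨ toℕ-injective (trans (toℕ-fromℕ< (m%n<n (toℕ y) n)) (m<n⇒m%n≡m (toℕ<n y))) ⟩
      y ∎)))
    where
    open ≡-Reasoning
    N = sum (map (length ∘ A) (allFin k))
    j = medianIndex (length (⨄ A))

    test-answers : ∀ m → Answers (testMedian j m) A (does (m ≤? toℕ y))
    test-answers m next = trans
      (announceSum-answers w (countBelow m)
        -- A count never exceeds the size, so the width `w` chosen for sizes also serves for counts.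
        (λ i → ≤-<-trans (length-filter _ (A i)) (len<2^w i)) (allFin k) _)
      (cong (λ b → run (next b) A) (trans
        (cong (λ c → does (c ≤? j)) (additive-⨄ (countBelow m) refl (countBelow-++ m) A))
        (does-⇔ (rank m) (_ ≤? j) (m ≤? toℕ y))))

  -- One round for the sizes and `l` rounds of bisection, each with `k` announcements of `w` bits.
  medianProtocol-bits : ∀ A → bitsBroadcast medianProtocol A ≤ k * w + l * (k * w)
  medianProtocol-bits A = ≤-trans
    (sum-costs length _ _ λ N → bisect-costs (test-costs (medianIndex N)) l 0 _ 0 λ v → z≤n)
    (≤-reflexive (cong (k * w +_) (+-identityʳ (l * (k * w)))))
    where
    sum-costs : ∀ f → Costs {O = Fin n} (announceSum w f (allFin k)) A (k * w)
    sum-costs f = subst (λ len → Costs (announceSum w f (allFin k)) A (len * w))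
      (length-tabulate {n = k} id) (announceSum-costs w f (allFin k))

    test-costs : ∀ j m → Costs (testMedian j m) A (k * w)
    test-costs j m next b next≤b = sum-costs (countBelow m) _ b λ c → next≤b _

-- Logarithmic bounds.

n<2^n : ∀ n → n < 2 ^ n
n<2^n zero    = s≤s z≤n
n<2^n (suc n) = begin-strict
  suc n         ≤⟨ n<2^n n ⟩
  2 ^ n         <⟨ ^-monoʳ-< 2 (s≤s (s≤s z≤n)) (n<1+n n) ⟩
  2 ^ suc n     ∎
  where open ≤-Reasoning

n<2^[1+⌊log₂n⌋] : ∀ n → n < 2 ^ suc ⌊log₂ n ⌋
n<2^[1+⌊log₂n⌋] n = ≰⇒> λ 2^≤n →
  <⇒≱ (n<1+n ⌊log₂ n ⌋) (subst (_≤ ⌊log₂ n ⌋) (⌊log₂[2^n]⌋≡n (suc ⌊log₂ n ⌋)) (⌊log₂⌋-mono-≤ 2^≤n))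

-- Along Horner's scheme, each multiplication by `n` costs at most `l` more bits and each added
-- coefficient `a` at most `a` more, which keeps the width linear in `l`.
eval<2^ : ∀ p {n l} → n ≤ 2 ^ l → eval p n < 2 ^ (sum p + length p * l)
eval<2^ []      n≤2^l = s≤s z≤n
eval<2^ (a ∷ p) {n} {l} n≤2^l = begin-strict
  a + n * r              ≤⟨ +-monoʳ-≤ a (*-monoˡ-≤ r n≤2^l) ⟩
  a + L * r              <⟨ +-monoˡ-< (L * r) (n<2^n a) ⟩
  -- Both `L` and `2 ^ a` are at least 1; inflating the summands yields the common factor
  -- `2 ^ a * L`, and the cofactor `suc r` suits the strict induction hypothesis.
  2 ^ a + L * r          ≤⟨ +-mono-≤ (m≤m*n (2 ^ a) L) (m≤n*m (L * r) (2 ^ a)) ⟩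
  2 ^ a * L + 2 ^ a * (L * r) ≡⟨ factor (2 ^ a) L r ⟩
  2 ^ a * L * suc r      ≤⟨ *-monoʳ-≤ (2 ^ a * L) (eval<2^ p n≤2^l) ⟩
  2 ^ a * L * 2 ^ e      ≡⟨ cong (_* 2 ^ e) (^-distribˡ-+-* 2 a l) ⟨
  2 ^ (a + l) * 2 ^ e    ≡⟨ ^-distribˡ-+-* 2 (a + l) e ⟨
  2 ^ (a + l + e)        ≡⟨ cong (2 ^_) (rearrange a l (sum p) (length p * l)) ⟩
  2 ^ (a + sum p + (l + length p * l)) ∎
  where
  open ≤-Reasoning
  r = eval p n
  L = 2 ^ l
  e = sum p + length p * l
  instance
    L≢0 : NonZero L
    L≢0 = m^n≢0 2 l
    2^a≢0 : NonZero (2 ^ a)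
    2^a≢0 = m^n≢0 2 a
  factor : ∀ x y z → x * y + x * (y * z) ≡ x * y * suc z
  factor = solve-∀
  rearrange : ∀ x y z u → x + y + (z + u) ≡ x + z + (y + u)
  rearrange = solve-∀

-- The left side is `l + 2` rounds of `k * (s + d * suc l)` bits. For `l` at least 1, `l + 2` is at
-- most `3 * l` and `s + d * suc l` at most `(s + 2 * d) * l`.
bits-bound : ∀ k s d {l} → 1 ≤ l →
  k * (s + d * suc l) + suc l * (k * (s + d * suc l)) ≤ 3 * (s + 2 * d) * (k * l ^ 2)
bits-bound k s d {suc l} _ = m+n≤o⇒m≤o _ (≤-reflexive (slack k s d l))
  where
  slack : ∀ k s d l →
    k * (s + d * suc (suc l)) + suc (suc l) * (k * (s + d * suc (suc l)))
      -- With `suc l` in place of `l`, the difference of the two sides has natural coefficients, so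
      -- the inequality becomes an identity.
      + k * (l * (5 * s + 7 * d) + l * l * (3 * s + 5 * d))
    ≡ 3 * (s + 2 * d) * (k * (suc l * (suc l * 1)))
  slack = solve-∀

theorem1 : ∀ (p : Polynomial) → ∃[ C ] (∀ (n k : ℕ) → 2 ≤ n → 1 ≤ k →
    Σ[ P ∈ Protocol k (Multiset n) (Fin n) ]
    (FindsMedian p P ×
    ComplexityAtMost (Admissible p) P (C * (k * ⌊log₂ n ⌋ ^ 2))))
theorem1 p = 3 * (sum p + 2 * length p) , λ n k 2≤n 1≤k →
  let l  = ⌊log₂ n ⌋
      -- Bisection needs `suc l` steps because rounding down only ensures `n < 2 ^ suc l`; `w` is
      -- the resulting width from `eval<2^`.
      w  = sum p + length p * suc l
      n≤ = <⇒≤ (n<2^[1+⌊log₂n⌋] n)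
      instance n≢0 = >-nonZero (<-≤-trans (s≤s z≤n) 2≤n)
  in medianProtocol k n w (suc l)
   , (λ A (short , A≢[]) → medianProtocol-median k n w (suc l) n≤ A
        (λ i → ≤-<-trans (short i) (eval<2^ p n≤)) A≢[])
   , λ A _ → ≤-trans (medianProtocol-bits k n w (suc l) A)
               -- Monotonicity at 2 gives `1 ≤ l`, as `⌊log₂ 2 ⌋` is 1.
               (bits-bound k (sum p) (length p) (⌊log₂⌋-mono-≤ 2≤n))
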